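{- Let $\Gamma\cup\{A\}\subseteq\mathcal{L}_\infty$ and let $t$ be the translation described in the context. (i) If $\Gamma^t\vdash_{\mathbf{K4}(Q)}A^t$, then $\Gamma\vdash_{\mathbf{K4}_h}A$. (ii) If $\Gamma^t\vdash_{\mathbf{S4}(Q)}A^t$, then $\Gamma\vdash_{\mathbf{S4}_h}A$.
   Context: The language $\mathcal{L}_\infty$ consists of modal formulas built from propositional atoms, $\bot,\top$, the connectives $\neg,\wedge,\vee,\rightarrow$ and unary modalities $\Box_n$ ($n\in\mathbb{N}$), with the restriction that $\Box_n A$ is a formula only if $n$ is strictly greater than the index of every box occurring in $A$. Axiom instances are only those that are $\mathcal{L}_\infty$-formulas. Axiom schemes (for all $n\ge0$): $\mathbf{H}$: $\Box_n A\rightarrow\Box_{n+1}A$; $\mathbf{K}_h$: $\Box_n(A\rightarrow B)\rightarrow(\Box_nA\rightarrow\Box_nB)$; $\mathbf{4}_h$: $\Box_nA\rightarrow\Box_{n+1}\Box_nA$; $\mathbf{T}_h$: $\Box_nA\rightarrow A$. For a set $X$ of schemes, $L(X)$ is the least set of $\mathcal{L}_\infty$-formulas containing all classical propositional tautologies and all instances of the schemes in $X$, closed under modus ponens and the rule: from $A$ infer $\Box_nA$ for any $n$ greater than all box indices in $A$. $\mathbf{K4}_h=L(\mathbf{H},\mathbf{K}_h,\mathbf{4}_h)$, $\mathbf{S4}_h=L(\mathbf{H},\mathbf{K}_h,\mathbf{4}_h,\mathbf{T}_h)$. For a set $\Gamma$, $\Gamma\vdash_LA$ means $\bigwedge\Delta\rightarrow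 A\in L$ for some finite $\Delta\subseteq\Gamma$ (analogously for the ordinary logics below). Let $Q=\{q_n\}_{n\ge0}$ be new propositional atoms not occurring in $\mathcal{L}_\infty$-formulas, and let $\mathcal{L}_\Box(Q)$ be the ordinary unimodal language (single modality $\Box$) over the atoms together with $Q$; $\mathbf{K4}(Q)$ and $\mathbf{S4}(Q)$ are the usual modal logics $\mathbf{K4}$ and $\mathbf{S4}$ in this language. The translation $t:\mathcal{L}_\infty\to\mathcal{L}_\Box(Q)$: $p^t=p$ for atoms, $t$ commutes with $\neg,\wedge,\vee,\rightarrow$, and $(\Box_nA)^t=\Box(\bigwedge_{i=0}^n q_i\rightarrow A^t)$. $\Gamma^t=\{B^t:B\in\Gamma\}$. -}

module Defs where

open import Data.Bool using (Bool; true; false; not; _∧_; _∨_)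
open import Data.List using (List; foldr)
open import Data.List.Relation.Unary.All using (All)
open import Data.Nat using (ℕ; zero; suc; _<_)
open import Data.Product using (∃-syntax; _×_)
open import Data.Sum using (_⊎_; inj₁; inj₂)
open import Data.Unit using (⊤; tt)
open import Level using (0ℓ)
open import Relation.Binary.PropositionalEquality using (_≡_)
open import Relation.Unary using (Pred; _∈_; _∪_)

infix  10 ¬ᶠ_
infixr 8 _∧ᶠ_
infixr 7 _∨ᶠ_
infixr 6 _⇒_
infix  4 _≺_ _⊢[_]_

-- Modal formulas over the atoms P with one unary modality for each i : I.
data Form (I P : Set) : Set where
  atom           : P → Form I P
  ⊥ᶠ ⊤ᶠ          : Form I P
  ¬ᶠ_            : Form I P → Form I P
  _∧ᶠ_ _∨ᶠ_ _⇒_  : Form I P → Form I P → Form I P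
  □              : I → Form I P → Form I P

private
  variable
    I P : Set

⋀ : List (Form I P) → Form I P
⋀ = foldr _∧ᶠ_ ⊤ᶠ

-- Boxed formulas are propositionally opaque: β assigns them arbitrary values.
eval : (P → Bool) → (I → Form I P → Bool) → Form I P → Bool
eval α β (atom p) = α p
eval α β ⊥ᶠ       = false
eval α β ⊤ᶠ       = true
eval α β (¬ᶠ A)   = not (eval α β A)
eval α β (A ∧ᶠ B) = eval α β A ∧ eval α β B
eval α β (A ∨ᶠ B) = eval α β A ∨ eval α β B
eval α β (A ⇒ B)  = not (eval α β A) ∨ eval α β B
eval α β (□ i A)  = β i A

Tautology : Pred (Form I P) 0ℓ
Tautology A = ∀ α β → eval α β A ≡ true

_⊢[_]_ : Pred (Form I P) 0ℓ → Pred (Form I P) 0ℓ → Form I P → Set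
Γ ⊢[ L ] A = ∃[ Δ ] (All (_∈ Γ) Δ × (⋀ Δ ⇒ A) ∈ L)

-- A ≺ n: every box occurring in A has index strictly below n.
_≺_ : Form ℕ P → ℕ → Set
atom p ≺ n   = ⊤
⊥ᶠ ≺ n       = ⊤
⊤ᶠ ≺ n       = ⊤
¬ᶠ A ≺ n     = A ≺ n
A ∧ᶠ B ≺ n   = A ≺ n × B ≺ n
A ∨ᶠ B ≺ n   = A ≺ n × B ≺ n
(A ⇒ B) ≺ n  = A ≺ n × B ≺ n
□ m A ≺ n    = m < n × A ≺ n

-- The language ℒ∞, as a subset of all formulas with boxes indexed by ℕ.
ℒ∞ : Pred (Form ℕ P) 0ℓ
ℒ∞ (atom p)  = ⊤
ℒ∞ ⊥ᶠ        = ⊤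
ℒ∞ ⊤ᶠ        = ⊤
ℒ∞ (¬ᶠ A)    = ℒ∞ A
ℒ∞ (A ∧ᶠ B)  = ℒ∞ A × ℒ∞ B
ℒ∞ (A ∨ᶠ B)  = ℒ∞ A × ℒ∞ B
ℒ∞ (A ⇒ B)   = ℒ∞ A × ℒ∞ B
ℒ∞ (□ n A)   = A ≺ n × ℒ∞ A

-- The schemes range over all formulas; Lₕ keeps only the instances in ℒ∞.
data Hₕ {P : Set} : Pred (Form ℕ P) 0ℓ where
  axH : ∀ {n A} → Hₕ (□ n A ⇒ □ (suc n) A)

data Kₕ {P : Set} : Pred (Form ℕ P) 0ℓ where
  axK : ∀ {n A B} → Kₕ (□ n (A ⇒ B) ⇒ (□ n A ⇒ □ n B))

data 4ₕ {P : Set} : Pred (Form ℕ P) 0ℓ where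
  ax4 : ∀ {n A} → 4ₕ (□ n A ⇒ □ (suc n) (□ n A))

data Tₕ {P : Set} : Pred (Form ℕ P) 0ℓ where
  axT : ∀ {n A} → Tₕ (□ n A ⇒ A)

data Lₕ {P : Set} (X : Pred (Form ℕ P) 0ℓ) : Pred (Form ℕ P) 0ℓ where
  taut : ∀ {A} → A ∈ ℒ∞ → A ∈ Tautology → A ∈ Lₕ X
  ax   : ∀ {A} → A ∈ ℒ∞ → A ∈ X → A ∈ Lₕ X
  mp   : ∀ {A B} → (A ⇒ B) ∈ Lₕ X → A ∈ Lₕ X → B ∈ Lₕ X
  nec  : ∀ {n A} → A ≺ n → A ∈ Lₕ X → □ n A ∈ Lₕ X

K4ₕ S4ₕ : Pred (Form ℕ P) 0ℓ
K4ₕ = Lₕ (Hₕ ∪ Kₕ ∪ 4ₕ)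
S4ₕ = Lₕ (Hₕ ∪ Kₕ ∪ 4ₕ ∪ Tₕ)

-- The unimodal language is the case I = ⊤.
data K□ {P : Set} : Pred (Form ⊤ P) 0ℓ where
  axK : ∀ {A B} → K□ (□ tt (A ⇒ B) ⇒ (□ tt A ⇒ □ tt B))

data 4□ {P : Set} : Pred (Form ⊤ P) 0ℓ where
  ax4 : ∀ {A} → 4□ (□ tt A ⇒ □ tt (□ tt A))

data T□ {P : Set} : Pred (Form ⊤ P) 0ℓ where
  axT : ∀ {A} → T□ (□ tt A ⇒ A)

data L□ {P : Set} (X : Pred (Form ⊤ P) 0ℓ) : Pred (Form ⊤ P) 0ℓ where
  taut : ∀ {A} → A ∈ Tautology → A ∈ L□ X
  ax   : ∀ {A} → A ∈ X → A ∈ L□ X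
  mp   : ∀ {A B} → (A ⇒ B) ∈ L□ X → A ∈ L□ X → B ∈ L□ X
  nec  : ∀ {A} → A ∈ L□ X → □ tt A ∈ L□ X

K4 S4 : Pred (Form ⊤ P) 0ℓ
K4 = L□ (K□ ∪ 4□)
S4 = L□ (K□ ∪ 4□ ∪ T□)

-- ℒ□(Q): the original atoms p are inj₁ p, and the new atom qₙ is inj₂ n.
ℒ□Q : Set → Set
ℒ□Q P = Form ⊤ (P ⊎ ℕ)

K4Q S4Q : Pred (ℒ□Q P) 0ℓ
K4Q = K4
S4Q = S4

-- q₀ ∧ … ∧ qₙ
⋀q≤ : ℕ → ℒ□Q P
⋀q≤ zero    = atom (inj₂ zero)
⋀q≤ (suc n) = ⋀q≤ n ∧ᶠ atom (inj₂ (suc n))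

infix 20 _ᵗ _ᵗˢ

_ᵗ : Form ℕ P → ℒ□Q P
atom p ᵗ     = atom (inj₁ p)
⊥ᶠ ᵗ         = ⊥ᶠ
⊤ᶠ ᵗ         = ⊤ᶠ
(¬ᶠ A) ᵗ     = ¬ᶠ (A ᵗ)
(A ∧ᶠ B) ᵗ   = A ᵗ ∧ᶠ B ᵗ
(A ∨ᶠ B) ᵗ   = A ᵗ ∨ᶠ B ᵗ
(A ⇒ B) ᵗ    = A ᵗ ⇒ B ᵗ
□ n A ᵗ      = □ tt (⋀q≤ n ⇒ A ᵗ)

_ᵗˢ : Pred (Form ℕ P) 0ℓ → Pred (ℒ□Q P) 0ℓ
(Γ ᵗˢ) C = ∃[ B ] (B ∈ Γ × C ≡ B ᵗ)

{-# OPTIONS --safe #-}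
module Submission where

open import Data.Bool using (Bool; true; false; not; _∧_; _∨_)
open import Data.Bool.Properties using (T-≡)
open import Data.List using (List; []; _∷_)
open import Data.List.Relation.Unary.All as All using (All; []; _∷_)
open import Data.Nat using (ℕ; zero; suc; _<_; _≤_; _⊔_; _≤ᵇ_; s≤s)
open import Data.Nat.Properties using (≤-refl; ≤⇒≤ᵇ; ≤ᵇ⇒≤; _≤?_; <⇒≤; <⇒≱; ≰⇒>; n<1+n; n≤1+n; <-≤-trans; <-trans;
  m≤m⊔n; m≤n⊔m; m≤n⇒m<n∨m≡n; m<1+n⇒m<n∨m≡n; m<n⇒m<1+n)
open import Data.Product using (∃-syntax; _×_; _,_; proj₁; proj₂)
open import Data.Sum using (_⊎_; inj₁; inj₂; map₂)
open import Data.Unit using (⊤; tt)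
open import Function using (_∘_; Equivalence)
open import Level using (0ℓ)
open import Relation.Binary.Definitions using (DecidableEquality)
open import Relation.Binary.PropositionalEquality using (_≡_; refl; sym; trans; cong; cong₂; subst)
open import Relation.Nullary using (¬_; Dec; yes; no; contradiction)
open import Relation.Unary using (Pred; _∈_; _∪_; _⊆_)
open import Defs

-- The translation has a left inverse that can be read off a model whose
-- worlds carry levels, with levels dropping along proper accessibility steps.
-- Let lower D m express "D holds at a world of level m": qᵢ becomes ⊤ if i ≤ m
-- and ⊥ otherwise, and □ D becomes the conjunction of □ᵢ (lower D i) over
-- i < m, to which lower D m is added in the reflexive case S4 (so
-- for K4 the flag turns that conjunct into ⊥ᶠ ⇒ lower D m).  Since
-- lower D i only has boxes of index below i, this lies in ℒ∞.  Each axiom and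
-- rule of K4 (S4) is mapped into K4ₕ (S4ₕ), and by H the formula lower (A ᵗ) m
-- is equivalent to A as soon as all boxes of A have index below m.

infix 5 _⇔ᶠ_

private
  variable
    I P : Set

-- Propositional reasoning under a fixed valuation.

_⇔ᶠ_ : Form I P → Form I P → Form I P
A ⇔ᶠ B = (A ⇒ B) ∧ᶠ (B ⇒ A)

constant : Bool → Form I P
constant true  = ⊤ᶠ
constant false = ⊥ᶠ

-- A record, so that α, β and A can be inferred from a proof.
record Sat (α : P → Bool) (β : I → Form I P → Bool) (A : Form I P) : Set where
  constructor sat
  field eval≡true : eval α β A ≡ true

open Sat

module _ {α : P → Bool} {β : I → Form I P → Bool} where

  imp-intro : ∀ {A B} → (Sat α β A → Sat α β B) → Sat α β (A ⇒ B)
  imp-intro {A} f .eval≡true with eval α β A in eq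
  ... | true  = f (sat eq) .eval≡true
  ... | false = refl

  imp-elim : ∀ {A B} → Sat α β (A ⇒ B) → Sat α β A → Sat α β B
  imp-elim (sat f) (sat a) .eval≡true rewrite a = f

  and-intro : ∀ {A B} → Sat α β A → Sat α β B → Sat α β (A ∧ᶠ B)
  and-intro (sat a) (sat b) .eval≡true rewrite a = b

  and-elim : ∀ {A B} → Sat α β (A ∧ᶠ B) → Sat α β A × Sat α β B
  and-elim {A} (sat ab) with eval α β A in eq
  ... | true = sat eq , sat ab

  iff-intro : ∀ {A B} → eval α β A ≡ eval α β B → Sat α β (A ⇔ᶠ B)
  iff-intro {B = B} eq .eval≡true rewrite eq with eval α β B
  ... | true  = refl
  ... | false = refl

  iff-elim : ∀ {A B} → Sat α β (A ⇔ᶠ B) → eval α β A ≡ eval α β B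
  iff-elim {A} {B} (sat h) with eval α β A | eval α β B
  ... | true  | true  = refl
  ... | false | false = refl

≤⇒≤ᵇ≡true : ∀ {i m} → i ≤ m → (i ≤ᵇ m) ≡ true
≤⇒≤ᵇ≡true i≤m = Equivalence.to T-≡ (≤⇒≤ᵇ i≤m)

>⇒≤ᵇ≡false : ∀ {i m} → m < i → (i ≤ᵇ m) ≡ false
>⇒≤ᵇ≡false {i} {m} m<i with i ≤ᵇ m in eq
... | false = refl
... | true  = contradiction (≤ᵇ⇒≤ i m (Equivalence.from T-≡ eq)) (<⇒≱ m<i)

eval-constant : ∀ {α : P → Bool} {β : I → Form I P → Bool} b → eval α β (constant b) ≡ b
eval-constant true  = refl
eval-constant false = refl

constant-≺ : ∀ b {n} → constant {P = P} b ≺ n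
constant-≺ true  = tt
constant-≺ false = tt

constant∈ℒ∞ : ∀ b → constant {P = P} b ∈ ℒ∞
constant∈ℒ∞ true  = tt
constant∈ℒ∞ false = tt

-- Bounds on box indices, and finite sets of premises.

≺-mono : (A : Form ℕ P) {m n : ℕ} → m ≤ n → A ≺ m → A ≺ n
≺-mono (atom p)  m≤n h         = tt
≺-mono ⊥ᶠ        m≤n h         = tt
≺-mono ⊤ᶠ        m≤n h         = tt
≺-mono (¬ᶠ A)    m≤n h         = ≺-mono A m≤n h
≺-mono (A ∧ᶠ B)  m≤n (hA , hB) = ≺-mono A m≤n hA , ≺-mono B m≤n hB
≺-mono (A ∨ᶠ B)  m≤n (hA , hB) = ≺-mono A m≤n hA , ≺-mono B m≤n hB
≺-mono (A ⇒ B)   m≤n (hA , hB) = ≺-mono A m≤n hA , ≺-mono B m≤n hB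
≺-mono (□ k A)   m≤n (k<m , h) = <-≤-trans k<m m≤n , ≺-mono A m≤n h

rank : Form ℕ P → ℕ
rank (atom p) = 0
rank ⊥ᶠ       = 0
rank ⊤ᶠ       = 0
rank (¬ᶠ A)   = rank A
rank (A ∧ᶠ B) = rank A ⊔ rank B
rank (A ∨ᶠ B) = rank A ⊔ rank B
rank (A ⇒ B)  = rank A ⊔ rank B
rank (□ n A)  = suc n ⊔ rank A

≺-rank : (A : Form ℕ P) → A ≺ rank A
≺-rank (atom p) = tt
≺-rank ⊥ᶠ       = tt
≺-rank ⊤ᶠ       = tt
≺-rank (¬ᶠ A)   = ≺-rank A
≺-rank (A ∧ᶠ B) = ≺-mono A (m≤m⊔n _ _) (≺-rank A) , ≺-mono B (m≤n⊔m (rank A) _) (≺-rank B)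
≺-rank (A ∨ᶠ B) = ≺-mono A (m≤m⊔n _ _) (≺-rank A) , ≺-mono B (m≤n⊔m (rank A) _) (≺-rank B)
≺-rank (A ⇒ B)  = ≺-mono A (m≤m⊔n _ _) (≺-rank A) , ≺-mono B (m≤n⊔m (rank A) _) (≺-rank B)
≺-rank (□ n A)  = m≤m⊔n (suc n) (rank A) , ≺-mono A (m≤n⊔m (suc n) (rank A)) (≺-rank A)

⋀∈ℒ∞ : {Δ : List (Form ℕ P)} → All (_∈ ℒ∞) Δ → ⋀ Δ ∈ ℒ∞
⋀∈ℒ∞ []       = tt
⋀∈ℒ∞ (h ∷ hs) = h , ⋀∈ℒ∞ hs

ᵗ-preimage : {Γ : Pred (Form ℕ P) 0ℓ} {Δᵗ : List (ℒ□Q P)} → All (_∈ Γ ᵗˢ) Δᵗ →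
  ∃[ Δ ] (All (_∈ Γ) Δ × ⋀ Δᵗ ≡ ⋀ Δ ᵗ)
ᵗ-preimage []                      = [] , [] , refl
ᵗ-preimage ((B , B∈Γ , refl) ∷ hs) with ᵗ-preimage hs
... | Δ , Δ⊆Γ , eq = B ∷ Δ , B∈Γ ∷ Δ⊆Γ , cong (B ᵗ ∧ᶠ_) eq

-- Each index gets its own formula because `lower D i` changes with `i`. Stopping before `m` keeps
-- every box index below `m`.
stack : (ℕ → Form ℕ P) → ℕ → Form ℕ P
stack f zero    = ⊤ᶠ
stack f (suc m) = stack f m ∧ᶠ □ m (f m)

module _ {f : ℕ → Form ℕ P} (f≺ : ∀ i → f i ≺ i) where

  stack-≺ : ∀ {n} m → m ≤ n → stack f m ≺ n
  stack-≺ zero    m≤n = tt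
  stack-≺ (suc m) m<n = stack-≺ m (<⇒≤ m<n) , m<n , ≺-mono (f m) (<⇒≤ m<n) (f≺ m)

  stack∈ℒ∞ : (∀ i → f i ∈ ℒ∞) → ∀ m → stack f m ∈ ℒ∞
  stack∈ℒ∞ f∈ zero    = tt
  stack∈ℒ∞ f∈ (suc m) = stack∈ℒ∞ f∈ m , f≺ m , f∈ m

-- The lowering map and its propositional behaviour.

module Lowering (reflexive : Bool) where

  lower : ℒ□Q P → ℕ → Form ℕ P
  lower (atom (inj₁ p)) m = atom p
  lower (atom (inj₂ i)) m = constant (i ≤ᵇ m)
  lower ⊥ᶠ              m = ⊥ᶠ
  lower ⊤ᶠ              m = ⊤ᶠ
  lower (¬ᶠ D)          m = ¬ᶠ lower D m
  lower (D ∧ᶠ E)        m = lower D m ∧ᶠ lower E m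
  lower (D ∨ᶠ E)        m = lower D m ∨ᶠ lower E m
  lower (D ⇒ E)         m = lower D m ⇒ lower E m
  lower (□ tt D)        m = (constant reflexive ⇒ lower D m) ∧ᶠ stack (lower D) m

  lower-≺ : (D : ℒ□Q P) → ∀ m → lower D m ≺ m
  lower-≺ (atom (inj₁ p)) m = tt
  lower-≺ (atom (inj₂ i)) m = constant-≺ (i ≤ᵇ m)
  lower-≺ ⊥ᶠ              m = tt
  lower-≺ ⊤ᶠ              m = tt
  lower-≺ (¬ᶠ D)          m = lower-≺ D m
  lower-≺ (D ∧ᶠ E)        m = lower-≺ D m , lower-≺ E m
  lower-≺ (D ∨ᶠ E)        m = lower-≺ D m , lower-≺ E m
  lower-≺ (D ⇒ E)         m = lower-≺ D m , lower-≺ E m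
  lower-≺ (□ tt D)        m =
    (constant-≺ reflexive , lower-≺ D m) , stack-≺ (lower-≺ D) m ≤-refl

  lower∈ℒ∞ : (D : ℒ□Q P) → ∀ m → lower D m ∈ ℒ∞
  lower∈ℒ∞ (atom (inj₁ p)) m = tt
  lower∈ℒ∞ (atom (inj₂ i)) m = constant∈ℒ∞ (i ≤ᵇ m)
  lower∈ℒ∞ ⊥ᶠ              m = tt
  lower∈ℒ∞ ⊤ᶠ              m = tt
  lower∈ℒ∞ (¬ᶠ D)          m = lower∈ℒ∞ D m
  lower∈ℒ∞ (D ∧ᶠ E)        m = lower∈ℒ∞ D m , lower∈ℒ∞ E m
  lower∈ℒ∞ (D ∨ᶠ E)        m = lower∈ℒ∞ D m , lower∈ℒ∞ E m
  lower∈ℒ∞ (D ⇒ E)         m = lower∈ℒ∞ D m , lower∈ℒ∞ E m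
  lower∈ℒ∞ (□ tt D)        m =
    (constant∈ℒ∞ reflexive , lower∈ℒ∞ D m) , stack∈ℒ∞ (lower-≺ D) (lower∈ℒ∞ D) m

  module _ (α : P → Bool) (β : ℕ → Form ℕ P → Bool) (m : ℕ) where

    lower-α : P ⊎ ℕ → Bool
    lower-α (inj₁ p) = α p
    lower-α (inj₂ i) = i ≤ᵇ m

    lower-β : ⊤ → ℒ□Q P → Bool
    lower-β tt D = eval α β (lower (□ tt D) m)

    -- Boxes are opaque to `eval`, so `lower-β` may give a box the value of its lowering, a compound
    -- formula. Hence lowering at a fixed level preserves tautologies.
    eval-lower : (D : ℒ□Q P) → eval α β (lower D m) ≡ eval lower-α lower-β D
    eval-lower (atom (inj₁ p)) = refl
    eval-lower (atom (inj₂ i)) = eval-constant (i ≤ᵇ m)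
    eval-lower ⊥ᶠ              = refl
    eval-lower ⊤ᶠ              = refl
    eval-lower (¬ᶠ D)          = cong not (eval-lower D)
    eval-lower (D ∧ᶠ E)        = cong₂ _∧_ (eval-lower D) (eval-lower E)
    eval-lower (D ∨ᶠ E)        = cong₂ _∨_ (eval-lower D) (eval-lower E)
    eval-lower (D ⇒ E)         = cong₂ (λ a b → not a ∨ b) (eval-lower D) (eval-lower E)
    eval-lower (□ tt D)        = refl

    sat-lower-⋀q : ∀ {n} → n ≤ m → Sat α β (lower (⋀q≤ n) m)
    sat-lower-⋀q {zero}  n≤m = sat refl
    sat-lower-⋀q {suc n} n<m = and-intro (sat-lower-⋀q (<⇒≤ n<m))
      (sat (trans (eval-constant (suc n ≤ᵇ m)) (≤⇒≤ᵇ≡true n<m)))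

    -- The last conjunct, the one for `n` itself, has become `⊥ᶠ`.
    unsat-lower-⋀q : ∀ {n} → m < n → ¬ Sat α β (lower (⋀q≤ n) m)
    unsat-lower-⋀q {suc n} m<n h
      with () ← trans (sym (trans (eval-constant (suc n ≤ᵇ m)) (>⇒≤ᵇ≡false m<n)))
                      (proj₂ (and-elim h) .eval≡true)

-- Derived rules of the hierarchical logics.

module Hierarchy {P : Set} {X : Pred (Form ℕ P) 0ℓ}
  (H⊆X : Hₕ ⊆ X) (K⊆X : Kₕ ⊆ X) (4⊆X : 4ₕ ⊆ X) where

  private
    variable
      A B C : Form ℕ P

  Lₕ⊆ℒ∞ : Lₕ X ⊆ ℒ∞
  Lₕ⊆ℒ∞ (taut l _)  = l
  Lₕ⊆ℒ∞ (ax l _)    = l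
  Lₕ⊆ℒ∞ (mp f _)    = proj₂ (Lₕ⊆ℒ∞ f)
  Lₕ⊆ℒ∞ (nec A≺n a) = A≺n , Lₕ⊆ℒ∞ a

  -- Replaces propositional derivations by semantic arguments: the premises are curried into one
  -- tautology and then discharged by `mp`. That tautology lies in `ℒ∞` because theorems do.
  consequence : ∀ {Δ} → All (_∈ Lₕ X) Δ → B ∈ ℒ∞ →
    (∀ α β → All (Sat α β) Δ → Sat α β B) → B ∈ Lₕ X
  consequence []       l t = taut l (λ α β → t α β [] .eval≡true)
  consequence (p ∷ ps) l t =
    mp (consequence ps (Lₕ⊆ℒ∞ p , l) (λ α β hs → imp-intro λ h → t α β (h ∷ hs))) p

  ⇒-refl : A ∈ ℒ∞ → (A ⇒ A) ∈ Lₕ X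
  ⇒-refl l = consequence [] (l , l) λ _ _ _ → imp-intro λ h → h

  ⇒-trans : (A ⇒ B) ∈ Lₕ X → (B ⇒ C) ∈ Lₕ X → (A ⇒ C) ∈ Lₕ X
  ⇒-trans p q = consequence (p ∷ q ∷ []) (proj₁ (Lₕ⊆ℒ∞ p) , proj₂ (Lₕ⊆ℒ∞ q))
    λ { _ _ (f ∷ g ∷ []) → imp-intro (imp-elim g ∘ imp-elim f) }

  ⇒-weaken : A ∈ ℒ∞ → B ∈ Lₕ X → (A ⇒ B) ∈ Lₕ X
  ⇒-weaken l p = consequence (p ∷ []) (l , Lₕ⊆ℒ∞ p) λ { _ _ (h ∷ []) → imp-intro λ _ → h }

  ⇒-∧ : (A ⇒ B) ∈ Lₕ X → (A ⇒ C) ∈ Lₕ X → (A ⇒ B ∧ᶠ C) ∈ Lₕ X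
  ⇒-∧ p q = consequence (p ∷ q ∷ []) (proj₁ (Lₕ⊆ℒ∞ p) , proj₂ (Lₕ⊆ℒ∞ p) , proj₂ (Lₕ⊆ℒ∞ q))
    λ { _ _ (f ∷ g ∷ []) → imp-intro λ a → and-intro (imp-elim f a) (imp-elim g a) }

  ⇔-intro : (A ⇒ B) ∈ Lₕ X → (B ⇒ A) ∈ Lₕ X → (A ⇔ᶠ B) ∈ Lₕ X
  ⇔-intro p q = consequence (p ∷ q ∷ []) (Lₕ⊆ℒ∞ p , Lₕ⊆ℒ∞ q)
    λ { _ _ (f ∷ g ∷ []) → and-intro f g }

  ∧-fst : A ∈ ℒ∞ → B ∈ ℒ∞ → (A ∧ᶠ B ⇒ A) ∈ Lₕ X
  ∧-fst a b = consequence [] ((a , b) , a) λ _ _ _ → imp-intro (proj₁ ∘ and-elim)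

  ∧-snd : A ∈ ℒ∞ → B ∈ ℒ∞ → (A ∧ᶠ B ⇒ B) ∈ Lₕ X
  ∧-snd a b = consequence [] ((a , b) , b) λ _ _ _ → imp-intro (proj₂ ∘ and-elim)

  ⇒-curry : (A ∧ᶠ B ⇒ C) ∈ Lₕ X → (A ⇒ B ⇒ C) ∈ Lₕ X
  ⇒-curry p with Lₕ⊆ℒ∞ p
  ... | (a , b) , c = consequence (p ∷ []) (a , b , c)
    λ { _ _ (f ∷ []) → imp-intro λ x → imp-intro λ y → imp-elim f (and-intro x y) }

  ⇒-uncurry : (A ⇒ B ⇒ C) ∈ Lₕ X → (A ∧ᶠ B ⇒ C) ∈ Lₕ X
  ⇒-uncurry p with Lₕ⊆ℒ∞ p
  ... | a , b , c = consequence (p ∷ []) ((a , b) , c)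
    λ { _ _ (f ∷ []) → imp-intro λ xy → imp-elim (imp-elim f (proj₁ (and-elim xy))) (proj₂ (and-elim xy)) }

  ⇒-mp : (A ⇒ B ⇒ C) ∈ Lₕ X → (A ⇒ B) ∈ Lₕ X → (A ⇒ C) ∈ Lₕ X
  ⇒-mp p q = ⇒-trans (⇒-∧ (⇒-refl (proj₁ (Lₕ⊆ℒ∞ p))) q) (⇒-uncurry p)

  □-K : ∀ {n} → A ≺ n → A ∈ ℒ∞ → B ≺ n → B ∈ ℒ∞ → (□ n (A ⇒ B) ⇒ □ n A ⇒ □ n B) ∈ Lₕ X
  □-K A≺n a B≺n b = ax (((A≺n , B≺n) , a , b) , (A≺n , a) , B≺n , b) (K⊆X axK)

  □-mono : ∀ {n} → A ≺ n → B ≺ n → (A ⇒ B) ∈ Lₕ X → (□ n A ⇒ □ n B) ∈ Lₕ X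
  □-mono A≺n B≺n p with Lₕ⊆ℒ∞ p
  ... | a , b = mp (□-K A≺n a B≺n b) (nec (A≺n , B≺n) p)

  □-∧ : ∀ {n} → A ≺ n → A ∈ ℒ∞ → B ≺ n → B ∈ ℒ∞ →
    (□ n A ∧ᶠ □ n B ⇒ □ n (A ∧ᶠ B)) ∈ Lₕ X
  □-∧ A≺n a B≺n b = ⇒-uncurry (⇒-trans
    (□-mono A≺n (B≺n , A≺n , B≺n) (⇒-curry (⇒-refl (a , b))))
    (□-K B≺n b (A≺n , B≺n) (a , b)))

  -- Iterates `axH`; the bound on `A` only weakens as the index grows, so every instance stays in
  -- `ℒ∞`.
  □-raise : ∀ {n} m → n ≤ m → A ≺ n → A ∈ ℒ∞ → (□ n A ⇒ □ m A) ∈ Lₕ X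
  □-raise {n = n} m n≤m A≺n a with m≤n⇒m<n∨m≡n n≤m
  ... | inj₂ refl = ⇒-refl (A≺n , a)
  □-raise {A = A} (suc m) _ A≺n a | inj₁ (s≤s n≤m) = ⇒-trans (□-raise m n≤m A≺n a)
    (ax ((A≺m , a) , ≺-mono A (n≤1+n m) A≺m , a) (H⊆X axH))
    where A≺m = ≺-mono A n≤m A≺n

  □-4 : ∀ {n m} → n < m → A ≺ n → A ∈ ℒ∞ → (□ n A ⇒ □ m (□ n A)) ∈ Lₕ X
  □-4 {A = A} {n} n<m A≺n a = ⇒-trans
    (ax ((A≺n , a) , □A≺ , A≺n , a) (4⊆X ax4))
    (□-raise _ n<m □A≺ (A≺n , a))
    where □A≺ = n<1+n n , ≺-mono A (n≤1+n n) A≺n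

  stack-intro : {f : ℕ → Form ℕ P} → A ∈ ℒ∞ → ∀ m →
    (∀ {i} → i < m → (A ⇒ □ i (f i)) ∈ Lₕ X) → (A ⇒ stack f m) ∈ Lₕ X
  stack-intro a zero    p = consequence [] (a , tt) λ _ _ _ → imp-intro λ _ → sat refl
  stack-intro a (suc m) p = ⇒-∧ (stack-intro a m (p ∘ m<n⇒m<1+n)) (p ≤-refl)

  module _ {f : ℕ → Form ℕ P} (f≺ : ∀ i → f i ≺ i) (f∈ : ∀ i → f i ∈ ℒ∞) where

    stack-elim : ∀ {i} m → i < m → (stack f m ⇒ □ i (f i)) ∈ Lₕ X
    stack-elim (suc m) i<1+m with m<1+n⇒m<n∨m≡n i<1+m
    ... | inj₁ i<m  = ⇒-trans (∧-fst (stack∈ℒ∞ f≺ f∈ m) (f≺ m , f∈ m)) (stack-elim m i<m)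
    ... | inj₂ refl = ∧-snd (stack∈ℒ∞ f≺ f∈ m) (f≺ m , f∈ m)

    -- Conjunct by conjunct: every index below `j` is below both `i` and `m`, so its box can be
    -- extracted from `stack f m` and put under `□ i` by `□-4`. The bound `j ≤ i` keeps the boxed
    -- formula in `ℒ∞`.
    stack-4 : ∀ {i m} → i < m → ∀ j → j ≤ i → (stack f m ⇒ □ i (stack f j)) ∈ Lₕ X
    stack-4 {m = m} i<m zero    _   = ⇒-weaken (stack∈ℒ∞ f≺ f∈ m) (nec tt (taut tt λ _ _ → refl))
    stack-4 {m = m} i<m (suc j) j<i = ⇒-trans
      (⇒-∧ (stack-4 i<m j (<⇒≤ j<i))
           (⇒-trans (stack-elim m (<-trans j<i i<m)) (□-4 j<i (f≺ j) (f∈ j))))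
      (□-∧ (stack-≺ f≺ j (<⇒≤ j<i)) (stack∈ℒ∞ f≺ f∈ j)
           (j<i , ≺-mono (f j) (<⇒≤ j<i) (f≺ j)) (f≺ j , f∈ j))

  -- Treats both logics at once: `true` appeals to `axT`, while `false` makes the antecedent
  -- contradictory.
  ⇒-reflect : ∀ b → (b ≡ true → Tₕ ⊆ X) → ∀ {n} → A ≺ n → A ∈ ℒ∞ →
    (constant b ∧ᶠ □ n A ⇒ A) ∈ Lₕ X
  ⇒-reflect true  T⊆X A≺n a = ⇒-trans (∧-snd tt (A≺n , a)) (ax ((A≺n , a) , a) (T⊆X refl axT))
  ⇒-reflect false _   A≺n a = consequence [] ((tt , A≺n , a) , a) λ _ _ _ → sat refl

  -- Lowering preserves theorems and inverts the translation.

  module Conservativity (reflexive : Bool) (T⊆X : reflexive ≡ true → Tₕ ⊆ X) where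

    open Lowering reflexive

    lower-stack∈ℒ∞ : ∀ (D : ℒ□Q P) m → stack (lower D) m ∈ ℒ∞
    lower-stack∈ℒ∞ D = stack∈ℒ∞ (lower-≺ D) (lower∈ℒ∞ D)

    lower-□-snd : ∀ (D : ℒ□Q P) m → (lower (□ tt D) m ⇒ stack (lower D) m) ∈ Lₕ X
    lower-□-snd D m = ∧-snd (constant∈ℒ∞ reflexive , lower∈ℒ∞ D m) (lower-stack∈ℒ∞ D m)

    lower-□-elim : ∀ (D : ℒ□Q P) {i m} → i < m → (lower (□ tt D) m ⇒ □ i (lower D i)) ∈ Lₕ X
    lower-□-elim D {m = m} i<m =
      ⇒-trans (lower-□-snd D m) (stack-elim (lower-≺ D) (lower∈ℒ∞ D) m i<m)

    lower-□-intro : ∀ (D : ℒ□Q P) m → (constant reflexive ∧ᶠ A ⇒ lower D m) ∈ Lₕ X →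
      (∀ {i} → i < m → (A ⇒ □ i (lower D i)) ∈ Lₕ X) → (A ⇒ lower (□ tt D) m) ∈ Lₕ X
    lower-□-intro {A = A} D m p q with Lₕ⊆ℒ∞ p
    ... | (c , a) , d = ⇒-∧
      (consequence (p ∷ []) (a , c , d) λ { _ _ (f ∷ []) →
        imp-intro λ x → imp-intro λ y → imp-elim f (and-intro y x) })
      (stack-intro a m q)

    lower-nec : (D : ℒ□Q P) → (∀ m → lower D m ∈ Lₕ X) → ∀ m → lower (□ tt D) m ∈ Lₕ X
    lower-nec D p m = mp (lower-□-intro {A = ⊤ᶠ} D m
        (⇒-weaken (constant∈ℒ∞ reflexive , tt) (p m))
        (λ {i} _ → ⇒-weaken tt (nec (lower-≺ D i) (p i))))
      (taut tt λ _ _ → refl)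

    lower-4 : ∀ (D : ℒ□Q P) m → lower (□ tt D ⇒ □ tt (□ tt D)) m ∈ Lₕ X
    lower-4 D m = lower-□-intro (□ tt D) m
      -- The reflexive conjunct asks for `lower (□ tt D) m`, which is the antecedent itself.
      (∧-snd (constant∈ℒ∞ reflexive) (lower∈ℒ∞ (□ tt D) m))
      λ {i} i<m →
        let c≺ = constant-≺ reflexive
            c∈ = constant∈ℒ∞ reflexive
            D≺ = lower-≺ D i
            D∈ = lower∈ℒ∞ D i
        -- Under `□ i` the two conjuncts of `lower (□ tt D) i` are needed: the first is a weakening
        -- of `lower D i`, the second comes from `stack-4` with `j` equal to `i`.
        in ⇒-trans
          (⇒-∧ (⇒-trans (lower-□-elim D i<m)
                 (□-mono D≺ (c≺ , D≺) (⇒-curry (∧-fst D∈ c∈))))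
               (⇒-trans (lower-□-snd D m)
                 (stack-4 (lower-≺ D) (lower∈ℒ∞ D) i<m i ≤-refl)))
          (□-∧ (c≺ , D≺) (c∈ , D∈) (stack-≺ (lower-≺ D) i ≤-refl) (lower-stack∈ℒ∞ D i))

    lower-T : (D : ℒ□Q P) → reflexive ≡ true → ∀ m → lower (□ tt D ⇒ D) m ∈ Lₕ X
    lower-T D refl m = consequence [] (lower∈ℒ∞ (□ tt D) m , lower∈ℒ∞ D m)
      λ _ _ _ → imp-intro λ h → imp-elim (proj₁ (and-elim h)) (sat refl)

    lower-K : (D E : ℒ□Q P) → ∀ m → lower (□ tt (D ⇒ E) ⇒ □ tt D ⇒ □ tt E) m ∈ Lₕ X
    lower-K D E m = ⇒-curry (lower-□-intro E m
      (consequence [] ((constant∈ℒ∞ reflexive , f , d) , lower∈ℒ∞ E m) λ _ _ _ →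
        imp-intro λ h →
          let c , fd = and-elim h
              f , d = and-elim fd
          in imp-elim (imp-elim (proj₁ (and-elim f)) c) (imp-elim (proj₁ (and-elim d)) c))
      λ {i} i<m → ⇒-mp
        (⇒-trans (⇒-trans (∧-fst f d) (lower-□-elim (D ⇒ E) i<m))
          (□-K (lower-≺ D i) (lower∈ℒ∞ D i) (lower-≺ E i) (lower∈ℒ∞ E i)))
        (⇒-trans (∧-snd f d) (lower-□-elim D i<m)))
      where
      f = lower∈ℒ∞ (□ tt (D ⇒ E)) m
      d = lower∈ℒ∞ (□ tt D) m

    -- The third component is empty when the flag is `false`, so one axiom set covers both K4 and
    -- S4.
    lower-ax : ∀ {D} → D ∈ K□ ∪ 4□ ∪ (λ D → reflexive ≡ true × D ∈ T□) → ∀ m → lower D m ∈ Lₕ X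
    lower-ax (inj₁ (axK {D} {E}))        = lower-K D E
    lower-ax (inj₂ (inj₁ (ax4 {D})))     = lower-4 D
    lower-ax (inj₂ (inj₂ (r , axT {D}))) = lower-T D r

    module _ {Y : Pred (ℒ□Q P) 0ℓ}
      (Y⊆ : Y ⊆ K□ ∪ 4□ ∪ (λ D → reflexive ≡ true × D ∈ T□)) where

      -- The induction treats all levels together, since necessitation at level `m` uses the premise
      -- at `m` and at every lower level.
      lower-sound : ∀ {D} → D ∈ L□ Y → ∀ m → lower D m ∈ Lₕ X
      lower-sound {D} (taut t) m = taut (lower∈ℒ∞ D m) λ α β →
        trans (eval-lower α β m D) (t (lower-α α β m) (lower-β α β m))
      lower-sound (ax y)     m = lower-ax (Y⊆ y) m
      lower-sound (mp f d)   m = mp (lower-sound f m) (lower-sound d m)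
      lower-sound (nec {D} d) m = lower-nec D (lower-sound d) m

    -- Connectives are propositional. For `□ n A`, the guard `⋀q≤ n` lowers to something false at
    -- levels below `n` and true from `n` on, so the conjunct at `n` is the essential one and H
    -- yields those above it.
    lower-ᵗ : (A : Form ℕ P) → A ∈ ℒ∞ → ∀ m → A ≺ m → (lower (A ᵗ) m ⇔ᶠ A) ∈ Lₕ X

    lower-ᵗ-to : (A : Form ℕ P) → A ∈ ℒ∞ → ∀ m → A ≺ m → (lower (A ᵗ) m ⇒ A) ∈ Lₕ X
    lower-ᵗ-to A a m A≺m = consequence (lower-ᵗ A a m A≺m ∷ []) (lower∈ℒ∞ (A ᵗ) m , a)
      λ { _ _ (h ∷ []) → proj₁ (and-elim h) }

    lower-ᵗ-from : (A : Form ℕ P) → A ∈ ℒ∞ → ∀ m → A ≺ m → (A ⇒ lower (A ᵗ) m) ∈ Lₕ X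
    lower-ᵗ-from A a m A≺m = consequence (lower-ᵗ A a m A≺m ∷ []) (a , lower∈ℒ∞ (A ᵗ) m)
      λ { _ _ (h ∷ []) → proj₂ (and-elim h) }

    lower-ᵗ (atom p)  a       m h = consequence [] ((tt , tt) , tt , tt) λ _ _ _ → iff-intro refl
    lower-ᵗ ⊥ᶠ        a       m h = consequence [] ((tt , tt) , tt , tt) λ _ _ _ → iff-intro refl
    lower-ᵗ ⊤ᶠ        a       m h = consequence [] ((tt , tt) , tt , tt) λ _ _ _ → iff-intro refl
    lower-ᵗ (¬ᶠ A)    a       m h = consequence (lower-ᵗ A a m h ∷ [])
      ((lower∈ℒ∞ (A ᵗ) m , a) , a , lower∈ℒ∞ (A ᵗ) m)
      λ { _ _ (p ∷ []) → iff-intro (cong not (iff-elim p)) }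
    lower-ᵗ (A ∧ᶠ B) (a , b) m (hA , hB) = consequence (lower-ᵗ A a m hA ∷ lower-ᵗ B b m hB ∷ [])
      (((lower∈ℒ∞ (A ᵗ) m , lower∈ℒ∞ (B ᵗ) m) , a , b) , (a , b) , lower∈ℒ∞ (A ᵗ) m , lower∈ℒ∞ (B ᵗ) m)
      λ { _ _ (p ∷ q ∷ []) → iff-intro (cong₂ _∧_ (iff-elim p) (iff-elim q)) }
    lower-ᵗ (A ∨ᶠ B) (a , b) m (hA , hB) = consequence (lower-ᵗ A a m hA ∷ lower-ᵗ B b m hB ∷ [])
      (((lower∈ℒ∞ (A ᵗ) m , lower∈ℒ∞ (B ᵗ) m) , a , b) , (a , b) , lower∈ℒ∞ (A ᵗ) m , lower∈ℒ∞ (B ᵗ) m)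
      λ { _ _ (p ∷ q ∷ []) → iff-intro (cong₂ _∨_ (iff-elim p) (iff-elim q)) }
    lower-ᵗ (A ⇒ B) (a , b) m (hA , hB) = consequence (lower-ᵗ A a m hA ∷ lower-ᵗ B b m hB ∷ [])
      (((lower∈ℒ∞ (A ᵗ) m , lower∈ℒ∞ (B ᵗ) m) , a , b) , (a , b) , lower∈ℒ∞ (A ᵗ) m , lower∈ℒ∞ (B ᵗ) m)
      λ { _ _ (p ∷ q ∷ []) → iff-intro (cong₂ (λ x y → not x ∨ y) (iff-elim p) (iff-elim q)) }
    lower-ᵗ (□ n A) (A≺n , a) m (n<m , A≺m) = ⇔-intro to from
      where
      q⇒A : ℕ → Form ℕ P
      q⇒A = lower (⋀q≤ n ⇒ A ᵗ)

      A⇒q⇒A : ∀ i → A ≺ i → (A ⇒ q⇒A i) ∈ Lₕ X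
      A⇒q⇒A i A≺i = ⇒-curry (⇒-trans (∧-fst a (lower∈ℒ∞ (⋀q≤ n) i)) (lower-ᵗ-from A a i A≺i))

      q⇒A⇒A : (q⇒A n ⇒ A) ∈ Lₕ X
      q⇒A⇒A = ⇒-trans
        (consequence [] (lower∈ℒ∞ (⋀q≤ n ⇒ A ᵗ) n , lower∈ℒ∞ (A ᵗ) n)
          λ α β _ → imp-intro λ f → imp-elim f (sat-lower-⋀q α β n ≤-refl))
        (lower-ᵗ-to A a n A≺n)

      from : (□ n A ⇒ lower (□ n A ᵗ) m) ∈ Lₕ X
      from = lower-□-intro (⋀q≤ n ⇒ A ᵗ) m
        -- For S4 the reflexive conjunct follows from `□ n A` by reflection and weakening by the
        -- guard.
        (⇒-trans (⇒-reflect reflexive T⊆X A≺n a) (A⇒q⇒A m A≺m))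
        λ {i} _ → case≤ i (n ≤? i)
        where
        case≤ : ∀ i → Dec (n ≤ i) → (□ n A ⇒ □ i (q⇒A i)) ∈ Lₕ X
        case≤ i (yes n≤i) = ⇒-trans (□-raise i n≤i A≺n a)
          (□-mono A≺i (lower-≺ (⋀q≤ n ⇒ A ᵗ) i) (A⇒q⇒A i A≺i))
          where A≺i = ≺-mono A n≤i A≺n
        -- The guard fails at this level, so the conjunct is a necessitated tautology.
        case≤ i (no n≰i)  = ⇒-weaken (A≺n , a) (nec (lower-≺ (⋀q≤ n ⇒ A ᵗ) i)
          (consequence [] (lower∈ℒ∞ (⋀q≤ n ⇒ A ᵗ) i) λ α β _ → imp-intro λ q →
            contradiction q (unsat-lower-⋀q α β i (≰⇒> n≰i))))

      to : (lower (□ n A ᵗ) m ⇒ □ n A) ∈ Lₕ X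
      -- The conjunct at `n` is present because `n < m`, and its guard holds at level `n`.
      to = ⇒-trans (lower-□-elim (⋀q≤ n ⇒ A ᵗ) n<m)
        (□-mono (lower-≺ (⋀q≤ n ⇒ A ᵗ) n) A≺n q⇒A⇒A)

    conservative : {Y : Pred (ℒ□Q P) 0ℓ} →
      Y ⊆ K□ ∪ 4□ ∪ (λ D → reflexive ≡ true × D ∈ T□) →
      {Γ : Pred (Form ℕ P) 0ℓ} {A : Form ℕ P} → Γ ⊆ ℒ∞ → A ∈ ℒ∞ →
      Γ ᵗˢ ⊢[ L□ Y ] A ᵗ → Γ ⊢[ Lₕ X ] A
    conservative Y⊆ {Γ} {A} Γ⊆ℒ∞ a (Δᵗ , Δᵗ⊆Γᵗ , d) with ᵗ-preimage Δᵗ⊆Γᵗ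
    ... | Δ , Δ⊆Γ , eq = Δ , Δ⊆Γ ,
      -- Only finitely many premises occur, so one level exceeds every box index in `F`; there the
      -- lowering of the translated implication gives back `F`.
      mp (lower-ᵗ-to F f (rank F) (≺-rank F))
         (lower-sound Y⊆ (subst (λ D → (D ⇒ A ᵗ) ∈ L□ _) eq d) (rank F))
      where
      F = ⋀ Δ ⇒ A
      f = ⋀∈ℒ∞ (All.map Γ⊆ℒ∞ Δ⊆Γ) , a

theorem3p11 : {P : Set} → DecidableEquality P →
    (Γ : Pred (Form ℕ P) 0ℓ) (A : Form ℕ P) → Γ ⊆ ℒ∞ → A ∈ ℒ∞ →
    (Γ ᵗˢ ⊢[ K4Q ] A ᵗ → Γ ⊢[ K4ₕ ] A) ×
    (Γ ᵗˢ ⊢[ S4Q ] A ᵗ → Γ ⊢[ S4ₕ ] A)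
theorem3p11 _ Γ A Γ⊆ℒ∞ a =
  -- With the flag `false`, the requirement on `Tₕ` is vacuous.
  Hierarchy.Conservativity.conservative inj₁ (inj₂ ∘ inj₁) (inj₂ ∘ inj₂) false (λ ())
    (map₂ inj₁) Γ⊆ℒ∞ a ,
  Hierarchy.Conservativity.conservative inj₁ (inj₂ ∘ inj₁) (inj₂ ∘ inj₂ ∘ inj₁) true
    (λ _ → inj₂ ∘ inj₂ ∘ inj₂)
    (map₂ (map₂ (refl ,_))) Γ⊆ℒ∞ a
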